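{- Suppose $k$ and $d$ are positive integers with $1\le k-1\le d$. If $G$ is a finite graph with maximum degree $\Delta=\Delta(G)$, then \[\chi^k_d(G)\le\Delta\left(G^{\,d-k+2}\right)+1,\] and moreover, if $\Delta\neq 2$, \[\Delta\left(G^{\,d-k+2}\right)+1\le\Delta\,\frac{(\Delta-1)^{d-k+2}-1}{\Delta-2}+1 .\]
   Context: All graphs are simple and undirected with nonempty vertex set. $\Delta(H)$ denotes the maximum degree of a graph $H$. For $\ell\ge1$, $G^\ell$ is the $\ell$-th power of $G$: the graph on $V(G)$ in which two distinct vertices are adjacent if and only if their distance in $G$ is at most $\ell$. A shortest path in a graph $G$ is a path between some vertices $u,v$ whose length (number of edges) equals the graph distance between $u$ and $v$. A set $S\subseteq V(G)$ is $k,d$-independent in $G$ if every shortest path in $G$ of length at most $d$ contains fewer than $k$ vertices of $S$. The $k,d$-chromatic number $\chi^k_d(G)$ is the least positive integer $c$ such that some coloring $V(G)\to\{1,\dots,c\}$ has all color classes $k,d$-independent. -}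

module Defs where

open import Data.Bool.Base using (Bool; true; false)
open import Data.Fin.Base using (Fin; zero; suc; inject₁; fromℕ; opposite)
open import Data.Fin.Properties using (_≟_; any?; all?; opposite-involutive)
open import Data.Fin.Subset using (Subset; ∣_∣)
open import Data.Integer.Base as ℤ using (ℤ)
import Data.Integer.Properties as ℤ
open import Data.Nat.Base
open import Data.Nat.Properties hiding (_≟_)
open import Data.Product.Base using (Σ; ∃; _×_; _,_; proj₁; proj₂)
open import Data.Rational.Base as ℚ using (ℚ)
import Data.Rational.Properties as ℚ
import Data.Rational.Unnormalised.Base as ℚᵘ
open import Data.Vec.Base using (tabulate; lookup)
open import Data.Vec.Functional using (foldr; _∷_; [])
open import Data.Vec.Properties using (tabulate-cong; lookup∘tabulate)
open import Function.Base using (_∘_; id)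
open import Function.Definitions using (Injective)
open import Level using (0ℓ)
open import Relation.Binary.Core using (Rel)
import Relation.Binary.Definitions as B
open import Relation.Binary.PropositionalEquality
open import Relation.Nullary using (¬_; Dec; yes; no; does; contradiction)
open import Relation.Nullary.Decidable using (map′; decidable-stable; ¬?; _×-dec_; _→-dec_)
open import Relation.Unary using (Pred; Decidable)

------------------------------------------------------------------------
-- Finite simple graphs

-- Adjacency is required to be decidable, which is no restriction classically
-- and makes degrees and chromatic numbers computable.

record Graph : Set₁ where
  infix 4 _~_ _~?_
  field
    order        : ℕ
    {{nonempty}} : NonZero order
    _~_          : Rel (Fin order) 0ℓ
    _~?_         : B.Decidable _~_
    ~-sym        : B.Symmetric _~_
    ~-irrefl     : B.Irreflexive _≡_ _~_

  V : Set
  V = Fin order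

open Graph using (V; order)

subsetOf : ∀ {n} {P : Pred (Fin n) 0ℓ} → Decidable P → Subset n
subsetOf P? = tabulate (does ∘ P?)

neighbours : (G : Graph) → V G → Subset (order G)
neighbours G v = subsetOf (v ~?_) where open Graph G

degree : (G : Graph) → V G → ℕ
degree G v = ∣ neighbours G v ∣

Δ : Graph → ℕ
Δ G = foldr _⊔_ 0 (degree G)

------------------------------------------------------------------------
-- Paths and distance

-- p is a path of length m, given by its m + 1 vertices in order.

record IsPath (G : Graph) (u v : V G) {m : ℕ} (p : Fin (suc m) → V G) : Set where
  constructor mkPath
  open Graph G using (_~_)
  field
    start    : p zero ≡ u
    end      : p (fromℕ m) ≡ v
    linked   : ∀ i → p (inject₁ i) ~ p (suc i)
    distinct : Injective _≡_ _≡_ p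

PathOfLength : (G : Graph) → V G → V G → ℕ → Set
PathOfLength G u v m = Σ (Fin (suc m) → V G) (IsPath G u v)

-- Vertices in different components are at no (i.e. infinite) distance.

IsDistance : (G : Graph) → V G → V G → ℕ → Set
IsDistance G u v m = PathOfLength G u v m × (∀ {j} → j < m → ¬ PathOfLength G u v j)

IsShortestPath : (G : Graph) (u v : V G) {m : ℕ} → (Fin (suc m) → V G) → Set
IsShortestPath G u v {m} p = IsPath G u v p × IsDistance G u v m

------------------------------------------------------------------------
-- Search over functions between finite sets

∷-≗ : ∀ {n m} (f : Fin (suc n) → Fin m) → (f zero ∷ (f ∘ suc)) ≗ f
∷-≗ f zero    = refl
∷-≗ f (suc i) = refl

anyFun? : ∀ {n m} {P : Pred (Fin n → Fin m) 0ℓ} → (∀ {f g} → f ≗ g → P f → P g) →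
          Decidable P → Dec (∃ P)
anyFun? {zero} resp P? =
  map′ (λ p → [] , p) (λ (f , p) → resp (λ ()) p) (P? [])
anyFun? {suc n} resp P? =
  map′ (λ (x , f , p) → x ∷ f , p)
       (λ (f , p) → f zero , f ∘ suc , resp (sym ∘ ∷-≗ f) p)
       (any? λ x → anyFun? (λ f≗g → resp λ { zero → refl ; (suc i) → f≗g i })
                           (P? ∘ (x ∷_)))

allFun? : ∀ {n m} {P : Pred (Fin n → Fin m) 0ℓ} → (∀ {f g} → f ≗ g → P f → P g) →
          Decidable P → Dec (∀ f → P f)
allFun? resp P? =
  map′ (λ ¬∃¬ f → decidable-stable (P? f) (λ ¬p → ¬∃¬ (f , ¬p)))
       (λ ∀p (f , ¬p) → ¬p (∀p f))
       (¬? (anyFun? (λ f≗g ¬p → ¬p ∘ resp (sym ∘ f≗g)) (¬? ∘ P?)))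

------------------------------------------------------------------------
-- Decidability of distance

module _ (G : Graph) where
  open Graph G using (_~_; _~?_; ~-sym)

  IsPath-resp : ∀ {u v m} {p q : Fin (suc m) → V G} → p ≗ q → IsPath G u v p → IsPath G u v q
  IsPath-resp p≗q (mkPath s e l d) = mkPath
    (trans (sym (p≗q _)) s) (trans (sym (p≗q _)) e)
    (λ i → subst₂ _~_ (p≗q _) (p≗q _) (l i))
    (λ {i} {j} eq → d (trans (p≗q i) (trans eq (sym (p≗q j)))))

  isPath? : ∀ u v {m} (p : Fin (suc m) → V G) → Dec (IsPath G u v p)
  isPath? u v p =
    map′ (λ (s , e , l , d) → mkPath s e l (λ {i} {j} → d i j))
         (λ (mkPath s e l d) → s , e , l , λ i j → d)
         ((p _ ≟ u) ×-dec (p _ ≟ v) ×-dec all? (λ i → p _ ~? p _)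
           ×-dec all? (λ i → all? λ j → (p i ≟ p j) →-dec (i ≟ j)))

  pathOfLength? : ∀ u v → Decidable (PathOfLength G u v)
  pathOfLength? u v m = anyFun? IsPath-resp (isPath? u v)

  isDistance? : ∀ u v → Decidable (IsDistance G u v)
  isDistance? u v m = pathOfLength? u v m ×-dec allUpTo? (¬? ∘ pathOfLength? u v) m

  opposite-fromℕ : ∀ m → opposite (fromℕ m) ≡ zero
  opposite-fromℕ m = opposite-involutive zero

  opposite-inject₁ : ∀ {m} (i : Fin m) → opposite (inject₁ i) ≡ suc (opposite i)
  opposite-inject₁ i = begin
    opposite (inject₁ i)                       ≡⟨ cong (opposite ∘ inject₁) (opposite-involutive i) ⟨
    opposite (inject₁ (opposite (opposite i))) ≡⟨ opposite-involutive (suc (opposite i)) ⟩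
    suc (opposite i)                           ∎
    where open ≡-Reasoning

  reversePath : ∀ {u v m} → PathOfLength G u v m → PathOfLength G v u m
  reversePath {m = m} (p , mkPath s e l d) = p ∘ opposite , mkPath
    e
    (trans (cong p (opposite-fromℕ m)) s)
    (λ i → ~-sym (subst (λ x → p (opposite (suc i)) ~ p x) (sym (opposite-inject₁ i)) (l (opposite i))))
    (λ {i} {j} eq → trans (sym (opposite-involutive i))
                      (trans (cong opposite (d eq)) (opposite-involutive j)))

  isDistance-sym : ∀ {u v m} → IsDistance G u v m → IsDistance G v u m
  isDistance-sym (p , min) = reversePath p , λ j<m → min j<m ∘ reversePath

------------------------------------------------------------------------
-- Graph powers

infixr 8 _^ᴳ_

_^ᴳ_ : Graph → ℕ → Graph
G ^ᴳ ℓ = record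
  { order    = order G
  ; nonempty = Graph.nonempty G
  ; _~_      = λ u v → u ≢ v × ∃ λ m → m < suc ℓ × IsDistance G u v m
  ; _~?_     = λ u v → ¬? (u ≟ v) ×-dec anyUpTo? (isDistance? G u v) (suc ℓ)
  ; ~-sym    = λ (u≢v , m , m≤ℓ , dist) → u≢v ∘ sym , m , m≤ℓ , isDistance-sym G dist
  ; ~-irrefl = λ u≡v (u≢v , _) → u≢v u≡v
  }

------------------------------------------------------------------------
-- k,d-independence and the k,d-chromatic number

-- The set of positions of p holding a vertex of S.  A path has no repeated
-- vertices, so its cardinality is the number of vertices of S on the path.

positionsIn : ∀ {n m} → Subset n → (Fin m → Fin n) → Subset m
positionsIn S p = tabulate (lookup S ∘ p)

Independent : (G : Graph) (k d : ℕ) → Subset (order G) → Set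
Independent G k d S =
  ∀ u v {m} → m < suc d → (p : Fin (suc m) → V G) → IsShortestPath G u v p →
  ∣ positionsIn S p ∣ < k

colourClass : ∀ {n c} → (Fin n → Fin c) → Fin c → Subset n
colourClass f i = subsetOf (λ v → f v ≟ i)

IsColouring : (G : Graph) (k d : ℕ) {c : ℕ} → (V G → Fin c) → Set
IsColouring G k d f = ∀ i → Independent G k d (colourClass f i)

Colourable : (G : Graph) (k d c : ℕ) → Set
Colourable G k d c = Σ (V G → Fin c) (IsColouring G k d)

IsChromaticNumber : (G : Graph) (k d c : ℕ) → Set
IsChromaticNumber G k d c =
  (1 ≤ c × Colourable G k d c) × (∀ j → 1 ≤ j × Colourable G k d j → c ≤ j)

module _ (G : Graph) (k d : ℕ) where

  independent? : Decidable (Independent G k d)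
  independent? S =
    map′ (λ h u v {m} m<1+d p sp → h u v m<1+d p sp)
         (λ h u v {m} m<1+d p sp → h u v m<1+d p sp)
         (all? λ u → all? λ v → allUpTo? (bounded? u v) (suc d))
    where
    Bounded : ∀ u v m → (Fin (suc m) → V G) → Set
    Bounded u v m p = IsShortestPath G u v p → ∣ positionsIn S p ∣ < k

    bounded-resp : ∀ u v m {p q} → p ≗ q → Bounded u v m p → Bounded u v m q
    bounded-resp u v m p≗q h (path , dist) =
      subst (λ s → ∣ s ∣ < k) (tabulate-cong (cong (lookup S) ∘ p≗q))
        (h (IsPath-resp G (sym ∘ p≗q) path , dist))

    bounded? : ∀ u v → Decidable (λ m → ∀ p → Bounded u v m p)
    bounded? u v m = allFun? (bounded-resp u v m) λ p →
      (isPath? G u v p ×-dec isDistance? G u v m) →-dec (_ <? k)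

  colourable? : Decidable (Colourable G k d)
  colourable? c = anyFun?
    (λ f≗g h i → subst (Independent G k d)
                   (tabulate-cong λ v → cong (λ x → does (x ≟ i)) (f≗g v)) (h i))
    (λ f → all? λ i → independent? (colourClass f i))

∣tabulate∣≡0 : ∀ {n} (f : Fin n → Bool) → (∀ i → f i ≢ true) → ∣ tabulate f ∣ ≡ 0
∣tabulate∣≡0 {zero}  f none = refl
∣tabulate∣≡0 {suc n} f none with f zero in eq
... | true  = contradiction eq (none zero)
... | false = ∣tabulate∣≡0 (f ∘ suc) (none ∘ suc)

∣tabulate∣≤1 : ∀ {n} (f : Fin n → Bool) →
               (∀ i j → f i ≡ true → f j ≡ true → i ≡ j) → ∣ tabulate f ∣ ≤ 1
∣tabulate∣≤1 {zero}  f uniq = z≤n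
∣tabulate∣≤1 {suc n} f uniq with f zero in eq
... | true  = s≤s (≤-reflexive (∣tabulate∣≡0 (f ∘ suc) λ i fi → 0≢suc (uniq zero (suc i) eq fi)))
  where
  0≢suc : ∀ {i : Fin n} → zero ≢ suc i
  0≢suc ()
... | false = ∣tabulate∣≤1 (f ∘ suc) λ i j fi fj → suc-inj (uniq (suc i) (suc j) fi fj)
  where
  suc-inj : ∀ {i j : Fin n} → Fin.suc i ≡ suc j → i ≡ j
  suc-inj refl = refl

id-isColouring : ∀ G k d → 1 < k → IsColouring G k d id
id-isColouring G k d 1<k x u v _ p (path , _) =
  ≤-trans (s≤s (∣tabulate∣≤1 _ λ i j i∈ j∈ →
    IsPath.distinct path (trans (∈class i i∈) (sym (∈class j j∈))))) 1<k
  where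
  ∈class : ∀ i → lookup (colourClass id x) (p i) ≡ true → p i ≡ x
  ∈class i eq with p i ≟ x | trans (sym (lookup∘tabulate (λ v → does (v ≟ x)) (p i))) eq
  ... | yes pi≡x | _  = pi≡x
  ... | no  _    | ()

least : {P : Pred ℕ 0ℓ} → Decidable P → ∀ n → P n → ∃ λ m → P m × (∀ j → P j → m ≤ j)
least P? zero    Pn = zero , Pn , λ _ _ → z≤n
least P? (suc n) Pn with P? zero
... | yes P0 = zero , P0 , λ _ _ → z≤n
... | no ¬P0 with least (P? ∘ suc) n Pn
...   | m , Pm , min = suc m , Pm , λ { zero P0 → contradiction P0 ¬P0
                                      ; (suc j) Pj → s≤s (min j Pj) }

-- For k ≤ 1 there is no colouring at all, as a single vertex is a shortest path.

chromaticNumber-exists : ∀ G k d → 1 ≤ k ∸ 1 → ∃ (IsChromaticNumber G k d)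
chromaticNumber-exists G (suc k) d 1≤k =
  least (λ c → (1 ≤? c) ×-dec colourable? G (suc k) d c) (order G)
        (>-nonZero⁻¹ (order G) {{Graph.nonempty G}} , id , id-isColouring G (suc k) d (s≤s 1≤k))

χ : (G : Graph) (k d : ℕ) → 1 ≤ k ∸ 1 → ℕ
χ G k d 1≤k-1 = proj₁ (chromaticNumber-exists G k d 1≤k-1)

------------------------------------------------------------------------
-- The rational upper bound

fromℤ : ℤ → ℚ
fromℤ i = i ℚ./ 1

fromℕ-ℚ : ℕ → ℚ
fromℕ-ℚ n = fromℤ (ℤ.+ n)

D-2-nonZero : ∀ {D} → D ≢ 2 → ℚ.NonZero (fromℤ (ℤ.+ D ℤ.- ℤ.+ 2))
D-2-nonZero {D} D≢2 = ℚ.≢-nonZero λ eq →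
  D≢2 (ℤ.+-injective (ℤ.i-j≡0⇒i≡j (ℤ.+ D) (ℤ.+ 2) (toℤ eq)))
  where
  toℤ : ∀ {i} → fromℤ i ≡ ℚ.0ℚ → i ≡ ℤ.0ℤ
  toℤ {i} eq with ℚ./-injective-≃ (ℚᵘ.mkℚᵘ i 0) (ℚᵘ.mkℚᵘ ℤ.0ℤ 0) eq
  ... | ℚᵘ.*≡* i*1≡0 = trans (sym (ℤ.*-identityʳ i)) i*1≡0

-- ((D - 1)ᵐ - 1) / (D - 2); the numerator can be negative, e.g. for D = 1.

geometricQuotient : (D m : ℕ) → D ≢ 2 → ℚ
geometricQuotient D m D≢2 =
  fromℤ ((ℤ.+ D ℤ.- ℤ.1ℤ) ℤ.^ m ℤ.- ℤ.1ℤ) ℚ.÷ fromℤ (ℤ.+ D ℤ.- ℤ.+ 2)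
  where instance _ = D-2-nonZero D≢2

{-# OPTIONS --safe #-}

-- Colour G^ℓ greedily, ℓ = d − k + 2.  A path with at most d + 1 vertices that
-- meets a colour class k times has two of these k ≥ 2 vertices at most ℓ steps
-- apart, for otherwise it would have at least k + ℓ = d + 2 vertices; these two
-- would be adjacent in G^ℓ.  The degree of v in G^ℓ is at most the size of the
-- tree of non-backtracking walks of length at most ℓ from v, whose root has at
-- most Δ children and whose other nodes have at most Δ − 1.

module Submission where

open import Defs
open import Data.Bool.Base using (Bool; true; false)
open import Data.Fin.Base as Fin using (Fin; zero; suc; toℕ; inject₁; inject≤)
open import Data.Fin.Properties as Fin using (_≟_; any?)
open import Data.Fin.Subset as Subset using (Subset; ∣_∣; _∈_; _-_; inside; outside)
import Data.Fin.Subset.Properties as Subset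
open import Data.Integer.Base as ℤ using (ℤ)
import Data.Integer.Properties as ℤ
open import Data.Integer.Tactic.RingSolver using (solve-∀)
open import Data.List.Base as List using (List; []; _∷_; length; concatMap; filter; allFin)
open import Data.List.Membership.Propositional as List using () renaming (_∈_ to _∈ₗ_)
open import Data.List.Membership.Propositional.Properties
  using (∈-allFin; ∈-filter⁺; ∈-filter⁻; ∈-concatMap⁺)
open import Data.List.Properties using (length-++; filter-notAll)
open import Data.List.Relation.Unary.Any as Any using (here; there)
open import Data.Nat.Base
  using (ℕ; zero; suc; _+_; _*_; _∸_; _≤_; _<_; _⊔_; z≤n; s≤s; s≤s⁻¹; z<s)
open import Data.Nat.Coprimality as Coprimality using (1-coprimeTo)
open import Data.Nat.Properties hiding (_≟_)
open import Data.Product.Base using (∃; _×_; _,_; proj₁; proj₂)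
open import Data.Rational.Base as ℚ using (ℚ)
import Data.Rational.Properties as ℚ
open import Data.Vec.Base using (lookup; tabulate; _∷_; there)
open import Data.Vec.Functional using (foldr; updateAt)
open import Data.Vec.Functional.Properties using (updateAt-updates; updateAt-minimal)
open import Data.Vec.Properties using (lookup∘tabulate; lookup⇒[]=; []=⇒lookup)
open import Function.Base using (_∘_; const)
open import Function.Definitions using (Injective)
open import Level using (0ℓ)
open import Relation.Binary.PropositionalEquality
open import Relation.Nullary using (¬_; Dec; yes; no; does; contradiction)
open import Relation.Nullary.Decidable using (¬?; _×-dec_; decidable-stable; dec-true)
open import Relation.Unary using (Pred; Decidable)

open Graph using (V; order)

-- Subsets of finite sets

module _ {n} {P : Pred (Fin n) 0ℓ} (P? : Decidable P) where

  lookup-subsetOf⁻ : ∀ {x} → lookup (subsetOf P?) x ≡ true → P x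
  lookup-subsetOf⁻ {x} eq with P? x | trans (sym (lookup∘tabulate (does ∘ P?) x)) eq
  ... | yes Px | _ = Px
  ... | no  _  | ()

  ∈-subsetOf⁺ : ∀ {x} → P x → x ∈ subsetOf P?
  ∈-subsetOf⁺ {x} Px =
    lookup⇒[]= x _ (trans (lookup∘tabulate (does ∘ P?) x) (dec-true (P? x) Px))

  ∈-subsetOf⁻ : ∀ {x} → x ∈ subsetOf P? → P x
  ∈-subsetOf⁻ = lookup-subsetOf⁻ ∘ []=⇒lookup

injection⇒≤∣p∣ : ∀ {c n} (p : Subset n) (f : Fin c → Fin n) → Injective _≡_ _≡_ f →
                 (∀ i → f i ∈ p) → c ≤ ∣ p ∣
injection⇒≤∣p∣ {zero}  p f inj f∈p = z≤n
injection⇒≤∣p∣ {suc c} p f inj f∈p = ≤-<-trans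
  (injection⇒≤∣p∣ (p - f zero) (f ∘ suc) (Fin.suc-injective ∘ inj)
    λ i → Subset.x∈p∧x≢y⇒x∈p-y (f∈p (suc i)) (Fin.0≢1+n ∘ sym ∘ inj))
  (Subset.x∈p⇒∣p-x∣<∣p∣ (f∈p zero))

x∉p-x : ∀ {n} (p : Subset n) x → ¬ x ∈ p - x
x∉p-x (_ ∷ p) zero    ()
x∉p-x (_ ∷ p) (suc x) (there x∈p-x) = x∉p-x p x x∈p-x

∣p∣≤1+∣p-x∣ : ∀ {n} (p : Subset n) x → ∣ p ∣ ≤ suc ∣ p - x ∣
∣p∣≤1+∣p-x∣ (outside ∷ p) zero    = m≤n⇒m≤1+n (≤-reflexive (cong ∣_∣ (sym (Subset.p─⊥≡p p))))
∣p∣≤1+∣p-x∣ (inside  ∷ p) zero    = s≤s (≤-reflexive (cong ∣_∣ (sym (Subset.p─⊥≡p p))))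
∣p∣≤1+∣p-x∣ (outside ∷ p) (suc x) = ∣p∣≤1+∣p-x∣ p x
∣p∣≤1+∣p-x∣ (inside  ∷ p) (suc x) = s≤s (∣p∣≤1+∣p-x∣ p x)

-- Removing the head of the list from `p` costs at most one element. Nothing is asked about
-- repetitions in `xs`, so the bound applies to `ball`, where a vertex can be reached by several
-- walks.
∣p∣≤length : ∀ {n} (p : Subset n) xs → (∀ {x} → x ∈ p → x ∈ₗ xs) → ∣ p ∣ ≤ length xs
∣p∣≤length {n} p [] p⊆[] = ≤-reflexive
  (trans (cong ∣_∣ (Subset.Empty-unique λ { (x , x∈p) → contradiction (p⊆[] x∈p) λ () }))
         (Subset.∣⊥∣≡0 n))
∣p∣≤length p (y ∷ xs) p⊆y∷xs = ≤-trans (∣p∣≤1+∣p-x∣ p y) (s≤s (∣p∣≤length (p - y) xs tail⊆))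
  where
  tail⊆ : ∀ {x} → x ∈ p - y → x ∈ₗ xs
  tail⊆ x∈p-y with p⊆y∷xs (Subset.p─q⊆p p _ x∈p-y)
  ... | here refl  = contradiction x∈p-y (x∉p-x p y)
  ... | there x∈xs = x∈xs

-- Links degrees, counted on subsets, with adjacency lists; `f` is arbitrary because the induction
-- shifts it.
length-filter-tabulate : ∀ {n} {A : Set} {P : Pred A 0ℓ} (P? : Decidable P) (f : Fin n → A) →
                         length (filter P? (List.tabulate f)) ≡ ∣ subsetOf (P? ∘ f) ∣
length-filter-tabulate {zero}  P? f = refl
length-filter-tabulate {suc n} P? f with does (P? (f zero))
... | true  = cong suc (length-filter-tabulate P? (f ∘ suc))
... | false = length-filter-tabulate P? (f ∘ suc)

length-concatMap-≤ : ∀ {A B : Set} (f : A → List B) xs {b} →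
                     (∀ {x} → x ∈ₗ xs → length (f x) ≤ b) → length (concatMap f xs) ≤ length xs * b
length-concatMap-≤ f []       f≤ = z≤n
length-concatMap-≤ f (x ∷ xs) f≤ = ≤-trans (≤-reflexive (length-++ (f x)))
  (+-mono-≤ (f≤ (here refl)) (length-concatMap-≤ f xs (f≤ ∘ there)))

-- Sets of positions without close pairs

∣tabulate∣≤n∸ℓ : ∀ {n} (f : Fin n → Bool) ℓ → (∀ j → toℕ j < ℓ → f j ≢ true) →
                 ∣ tabulate f ∣ ≤ n ∸ ℓ
∣tabulate∣≤n∸ℓ         f zero    none = Subset.∣p∣≤n (tabulate f)
∣tabulate∣≤n∸ℓ {zero}  f (suc ℓ) none = z≤n
∣tabulate∣≤n∸ℓ {suc n} f (suc ℓ) none with f zero in eq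
... | true  = contradiction eq (none zero z<s)
... | false = ∣tabulate∣≤n∸ℓ (f ∘ suc) ℓ λ j j<ℓ → none (suc j) (s≤s j<ℓ)

-- Only the gap after the first position is used at its full length ℓ + 1.

spread⇒∣tabulate∣+ℓ≤n : ∀ {n} (f : Fin n → Bool) ℓ →
  (∀ i j → i Fin.< j → toℕ j ≤ toℕ i + ℓ → f i ≡ true → f j ≢ true) →
  2 ≤ ∣ tabulate f ∣ → ∣ tabulate f ∣ + ℓ ≤ n
spread⇒∣tabulate∣+ℓ≤n {suc n} f ℓ spread 2≤ with f zero in eq
... | false = m≤n⇒m≤1+n (spread⇒∣tabulate∣+ℓ≤n (f ∘ suc) ℓ
                (λ i j i<j j≤ → spread (suc i) (suc j) (s≤s i<j) (s≤s j≤)) 2≤)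
... | true  = s≤s (≤-trans (+-monoˡ-≤ ℓ rest≤) (≤-reflexive (m∸n+n≡m (<⇒≤ (m∸n≢0⇒n<m {n} {ℓ} n∸ℓ≢0)))))
  where
  rest≤ : ∣ tabulate (f ∘ suc) ∣ ≤ n ∸ ℓ
  rest≤ = ∣tabulate∣≤n∸ℓ (f ∘ suc) ℓ λ j j<ℓ → spread zero (suc j) z<s j<ℓ eq
  -- A second `true` value after the first rules out truncation in `n ∸ ℓ`, so adding `ℓ` gives back
  -- `n`.
  n∸ℓ≢0 : n ∸ ℓ ≢ 0
  n∸ℓ≢0 = m<n⇒n≢0 (≤-trans (s≤s⁻¹ 2≤) rest≤)

-- Degrees and greedy colouring

f≤foldr-⊔ : ∀ {n} (f : Fin n → ℕ) i → f i ≤ foldr _⊔_ 0 f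
f≤foldr-⊔ f zero    = m≤m⊔n (f zero) _
f≤foldr-⊔ f (suc i) = ≤-trans (f≤foldr-⊔ (f ∘ suc) i) (m≤n⊔m (f zero) _)

foldr-⊔-lub : ∀ {n} (f : Fin n → ℕ) {b} → (∀ i → f i ≤ b) → foldr _⊔_ 0 f ≤ b
foldr-⊔-lub {zero}  f f≤ = z≤n
foldr-⊔-lub {suc n} f f≤ = ⊔-lub (f≤ zero) (foldr-⊔-lub (f ∘ suc) (f≤ ∘ suc))

module Greedy (G : Graph) {c : ℕ} (Δ<c : Δ G < c) where
  open Graph G using (_~_; _~?_; ~-sym; ~-irrefl)

  -- Pigeonhole: if every colour were used, choosing one neighbour for each would embed the `c`
  -- colours into the neighbours of `v`, of which there are at most `Δ G < c`. The choice is
  -- injective since `f` recovers the colour.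
  freeColour : (f : V G → Fin c) (v : V G) → ∃ λ x → ¬ ∃ λ u → v ~ u × f u ≡ x
  freeColour f v = decidable-stable (any? λ x → ¬? (used? x)) λ none →
    let use : ∀ x → ∃ λ u → v ~ u × f u ≡ x
        use x = decidable-stable (used? x) λ unused → none (x , unused)
        colour-use : ∀ x → f (proj₁ (use x)) ≡ x
        colour-use x = proj₂ (proj₂ (use x))
    in <⇒≱ Δ<c (≤-trans
         (injection⇒≤∣p∣ (neighbours G v) (proj₁ ∘ use)
           (λ {x} {y} eq → trans (sym (colour-use x)) (trans (cong f eq) (colour-use y)))
           (λ x → ∈-subsetOf⁺ (v ~?_) (proj₁ (proj₂ (use x)))))
         (f≤foldr-⊔ (degree G) v))
    where
    used? : ∀ x → Dec (∃ λ u → v ~ u × f u ≡ x)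
    used? x = any? λ u → (v ~? u) ×-dec (f u ≟ x)

  -- Colourings are total functions, so vertices still to be treated carry a colour too; only pairs
  -- within `vs` are constrained.
  ProperOn : List (V G) → (V G → Fin c) → Set
  ProperOn vs f = ∀ {u v} → u ∈ₗ vs → v ∈ₗ vs → u ~ v → f u ≢ f v

  properOn : ∀ vs → ∃ (ProperOn vs)
  -- An arbitrary initial colour, available because `Δ<c` makes `c` positive.
  properOn [] = const (Fin.fromℕ< (≤-<-trans z≤n Δ<c)) , λ ()
  properOn (w ∷ vs) with properOn vs
  ... | f , proper with freeColour f w
  ...   | x , free = f′ , proper′
    where
    f′ : V G → Fin c
    f′ = updateAt f w (const x)
    f′w≡x : f′ w ≡ x
    f′w≡x = updateAt-updates w f
    f′u≡fu : ∀ {u} → u ≢ w → f′ u ≡ f u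
    f′u≡fu {u} u≢w = updateAt-minimal u w f u≢w
    f′w≢f′u : ∀ {u} → w ~ u → f′ w ≢ f′ u
    f′w≢f′u {u} w~u eq = free (u , w~u , trans (sym (f′u≡fu λ u≡w → ~-irrefl (sym u≡w) w~u))
                                            (trans (sym eq) f′w≡x))
    proper′ : ProperOn (w ∷ vs) f′
    proper′ {u} {v} u∈ v∈ u~v eq with u ≟ w | v ≟ w
    ... | yes refl | _        = f′w≢f′u u~v eq
    ... | no _     | yes refl = f′w≢f′u (~-sym u~v) (sym eq)
    ... | no u≢w   | no v≢w   = proper (Any.tail u≢w u∈) (Any.tail v≢w v∈) u~v
                                  (trans (sym (f′u≡fu u≢w)) (trans eq (f′u≡fu v≢w)))

  properColouring : ∃ λ (f : V G → Fin c) → ∀ {u v} → u ~ v → f u ≢ f v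
  properColouring with properOn (allFin (order G))
  ... | f , proper = f , proper (∈-allFin _) (∈-allFin _)

-- Paths and adjacency in powers

module _ (G : Graph) where
  open Graph G using (_~_)

  IsPath-tail : ∀ {u v m} {p : Fin (suc (suc m)) → V G} → IsPath G u v p →
                IsPath G (p (suc zero)) v (p ∘ suc)
  IsPath-tail (mkPath s e l d) = mkPath refl e (l ∘ suc) (Fin.suc-injective ∘ d)

  prefixPath : ∀ {u v m} {p : Fin (suc m) → V G} → IsPath G u v p → ∀ j →
               PathOfLength G u (p j) (toℕ j)
  prefixPath {m = m} {p} (mkPath s e l d) j = (λ i → p (inject≤ i 1+j≤1+m)) , mkPath s
    (cong p (Fin.toℕ-injective (trans (Fin.toℕ-inject≤ _ 1+j≤1+m) (Fin.toℕ-fromℕ _))))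
    -- `inject≤` commutes with `suc` by computation, but with `inject₁` only after comparing values.
    (λ i → subst (λ x → p x ~ p (suc (inject≤ i (Fin.toℕ≤pred[n] j))))
             (Fin.toℕ-injective (begin
               toℕ (inject₁ (inject≤ i (Fin.toℕ≤pred[n] j))) ≡⟨ Fin.toℕ-inject₁ _ ⟩
               toℕ (inject≤ i (Fin.toℕ≤pred[n] j))           ≡⟨ Fin.toℕ-inject≤ i (Fin.toℕ≤pred[n] j) ⟩
               toℕ i                                         ≡⟨ Fin.toℕ-inject₁ i ⟨
               toℕ (inject₁ i)                               ≡⟨ Fin.toℕ-inject≤ (inject₁ i) 1+j≤1+m ⟨
               toℕ (inject≤ (inject₁ i) 1+j≤1+m)             ∎))
             (l (inject≤ i (Fin.toℕ≤pred[n] j))))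
    (λ {i} {i′} eq → Fin.inject≤-injective 1+j≤1+m 1+j≤1+m i i′ (d eq))
    where
    open ≡-Reasoning
    1+j≤1+m : suc (toℕ j) ≤ suc m
    1+j≤1+m = Fin.toℕ<n j

  -- Vertices before position `i` are dropped one at a time; `prefixPath` then cuts off those after
  -- `j`.
  subpath : ∀ {u v m} {p : Fin (suc m) → V G} → IsPath G u v p → ∀ i j → i Fin.< j →
            PathOfLength G (p i) (p j) (toℕ j ∸ toℕ i)
  subpath {p = p} path zero j _ =
    prefixPath (record { IsPath path ; start = refl }) j
  subpath {m = suc m} path (suc i) (suc j) i<j = subpath (IsPath-tail path) i j (s≤s⁻¹ i<j)

  -- Adjacency in the power asks for the exact distance, while a path only bounds it; the distance
  -- is found as the least length of a path.
  path⇒~^ᴳ : ∀ {ℓ u v m} → u ≢ v → m ≤ ℓ → PathOfLength G u v m → Graph._~_ (G ^ᴳ ℓ) u v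
  path⇒~^ᴳ {u = u} {v} {m} u≢v m≤ℓ path with least (pathOfLength? G u v) m path
  ... | dist , shortest , min =
    u≢v , dist , s≤s (≤-trans (min m path) m≤ℓ) , shortest , λ j<dist → <⇒≱ j<dist ∘ min _

  proper^ᴳ⇒colouring : ∀ {ℓ k d c} {f : V G → Fin c} → 2 ≤ k → suc d < k + ℓ →
    (∀ {u v} → Graph._~_ (G ^ᴳ ℓ) u v → f u ≢ f v) → IsColouring G k d f
  proper^ᴳ⇒colouring {ℓ} {k} {f = f} 2≤k 1+d<k+ℓ proper x u v {m} m<1+d p (path , _) =
    -- With `k` or more positions in the class, `k + ℓ` is at most the number `suc m` of vertices on
    -- `p`, and `m<1+d` bounds that number by `suc d`.
    ≰⇒> λ k≤ → <⇒≱ 1+d<k+ℓ (≤-trans (+-monoˡ-≤ ℓ k≤)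
      (≤-trans (spread⇒∣tabulate∣+ℓ≤n _ ℓ spread (≤-trans 2≤k k≤)) m<1+d))
    where
    spread : ∀ i j → i Fin.< j → toℕ j ≤ toℕ i + ℓ →
             lookup (colourClass f x) (p i) ≡ true → lookup (colourClass f x) (p j) ≢ true
    spread i j i<j j≤i+ℓ i∈ j∈ = proper
      (path⇒~^ᴳ (λ eq → Fin.<⇒≢ i<j (IsPath.distinct path eq))
                (m≤n+o⇒m∸n≤o (toℕ j) (toℕ i) j≤i+ℓ) (subpath path i j i<j))
      (trans (lookup-subsetOf⁻ (λ w → f w ≟ x) i∈) (sym (lookup-subsetOf⁻ (λ w → f w ≟ x) j∈)))

-- Counting non-backtracking walks

-- The sum of the powers of `r` with exponents below `m`, in Horner form to match the recursion of
-- `branch`.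
geometricSum : ℕ → ℕ → ℕ
geometricSum r zero    = 0
geometricSum r (suc m) = 1 + r * geometricSum r m

module _ (G : Graph) where
  open Graph G using (_~_; _~?_; ~-sym)

  neighbourList : V G → List (V G)
  neighbourList v = filter (v ~?_) (allFin (order G))

  ∈-neighbourList⁺ : ∀ {u v} → v ~ u → u ∈ₗ neighbourList v
  ∈-neighbourList⁺ {u} {v} = ∈-filter⁺ (v ~?_) (∈-allFin u)

  ∈-neighbourList⁻ : ∀ {u v} → u ∈ₗ neighbourList v → v ~ u
  ∈-neighbourList⁻ {u} {v} = proj₂ ∘ ∈-filter⁻ (v ~?_) {xs = allFin _}

  length-neighbourList : ∀ v → length (neighbourList v) ≤ Δ G
  length-neighbourList v = ≤-trans (≤-reflexive (length-filter-tabulate (v ~?_) (λ u → u)))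
                                   (f≤foldr-⊔ (degree G) v)

  avoiding : V G → V G → List (V G)
  avoiding u v = filter (λ w → ¬? (w ≟ u)) (neighbourList v)

  -- By symmetry `u` is itself a neighbour of `v`, so the filter discards at least one entry.
  length-avoiding : ∀ {u v} → u ~ v → length (avoiding u v) ≤ Δ G ∸ 1
  length-avoiding {u} {v} u~v = <⇒≤pred (<-≤-trans
    (filter-notAll (λ w → ¬? (w ≟ u)) (neighbourList v)
      (Any.map (λ u≡w w≢u → w≢u (sym u≡w)) (∈-neighbourList⁺ (~-sym u~v))))
    (length-neighbourList v))

  -- The end vertices of the non-backtracking walks with at most m vertices that
  -- start at v, coming from u.

  branch : ℕ → V G → V G → List (V G)
  branch zero    u v = []
  branch (suc m) u v = v ∷ concatMap (branch m v) (avoiding u v)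

  length-branch : ∀ m {u v} → u ~ v → length (branch m u v) ≤ geometricSum (Δ G ∸ 1) m
  length-branch zero    u~v = z≤n
  length-branch (suc m) {u} {v} u~v = s≤s (≤-trans
    (length-concatMap-≤ (branch m v) (avoiding u v) λ w∈ →
      length-branch m (∈-neighbourList⁻ (proj₁ (∈-filter⁻ (λ w → ¬? (w ≟ u)) w∈))))
    (*-monoˡ-≤ _ (length-avoiding u~v)))

  -- Avoiding `w` after the first vertex puts the second vertex into `avoiding`. The condition
  -- passes to the tail, with the old first vertex as the new `w`, because a path never returns to a
  -- vertex.
  path⇒∈branch : ∀ {ℓ m w u v} {p : Fin (suc m) → V G} → m < ℓ → IsPath G u v p →
                 (∀ i → p (suc i) ≢ w) → v ∈ₗ branch ℓ w u
  path⇒∈branch {suc ℓ} {zero} _ (mkPath s e _ _) _ = here (trans (sym e) s)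
  path⇒∈branch {suc ℓ} {suc m} {w} {p = p} 1+m<1+ℓ path@(mkPath refl _ l d) avoid =
    there (∈-concatMap⁺ (branch ℓ (p zero)) (List.lose
      (∈-filter⁺ (λ x → ¬? (x ≟ w)) (∈-neighbourList⁺ (l zero)) (avoid zero))
      (path⇒∈branch (s≤s⁻¹ 1+m<1+ℓ) (IsPath-tail G path) λ i → Fin.0≢1+n ∘ sym ∘ d)))

  -- The root has no predecessor to avoid, so it branches to all its neighbours. Having at most `ℓ`
  -- vertices after the root means having length at most `ℓ`.
  ball : ℕ → V G → List (V G)
  ball ℓ v = concatMap (branch ℓ v) (neighbourList v)

  ~^ᴳ⇒∈ball : ∀ {ℓ u v} → Graph._~_ (G ^ᴳ ℓ) u v → v ∈ₗ ball ℓ u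
  ~^ᴳ⇒∈ball (u≢v , zero , _ , (p , mkPath s e _ _) , _) = contradiction (trans (sym s) e) u≢v
  ~^ᴳ⇒∈ball {ℓ} (_ , suc m , m<ℓ , (p , path@(mkPath refl _ l d)) , _) =
    ∈-concatMap⁺ (branch ℓ (p zero)) (List.lose (∈-neighbourList⁺ (l zero))
      (path⇒∈branch (s≤s⁻¹ m<ℓ) (IsPath-tail G path) λ i → Fin.0≢1+n ∘ sym ∘ d))

  Δ^ᴳ-≤ : ∀ ℓ → Δ (G ^ᴳ ℓ) ≤ Δ G * geometricSum (Δ G ∸ 1) ℓ
  Δ^ᴳ-≤ ℓ = foldr-⊔-lub (degree (G ^ᴳ ℓ)) λ v → begin
    degree (G ^ᴳ ℓ) v
      ≤⟨ ∣p∣≤length _ (ball ℓ v) (~^ᴳ⇒∈ball {ℓ} ∘ ∈-subsetOf⁻ (Graph._~?_ (G ^ᴳ ℓ) v)) ⟩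
    length (ball ℓ v)
      ≤⟨ length-concatMap-≤ (branch ℓ v) (neighbourList v) (length-branch ℓ ∘ ∈-neighbourList⁻) ⟩
    length (neighbourList v) * geometricSum (Δ G ∸ 1) ℓ
      ≤⟨ *-monoˡ-≤ _ (length-neighbourList v) ⟩
    Δ G * geometricSum (Δ G ∸ 1) ℓ ∎
    where open ≤-Reasoning

-- The closed form of the geometric sum

-- Division by 1 normalises through a gcd that is stuck on a variable `i`; the explicit form lets
-- rational arithmetic compute.
fromℤ≡mkℚ : ∀ i → fromℤ i ≡ ℚ.mkℚ i 0 (Coprimality.sym (1-coprimeTo _))
fromℤ≡mkℚ i = ℚ.↥p/↧p≡p (ℚ.mkℚ i 0 (Coprimality.sym (1-coprimeTo _)))

fromℤ-+ : ∀ i j → fromℤ (i ℤ.+ j) ≡ fromℤ i ℚ.+ fromℤ j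
fromℤ-+ i j rewrite fromℤ≡mkℚ i | fromℤ≡mkℚ j =
  cong fromℤ (sym (cong₂ ℤ._+_ (ℤ.*-identityʳ i) (ℤ.*-identityʳ j)))

fromℤ-* : ∀ i j → fromℤ (i ℤ.* j) ≡ fromℤ i ℚ.* fromℤ j
fromℤ-* i j rewrite fromℤ≡mkℚ i | fromℤ≡mkℚ j = refl

fromℤ-mono-≤ : ∀ {i j} → i ℤ.≤ j → fromℤ i ℚ.≤ fromℤ j
fromℤ-mono-≤ {i} {j} i≤j rewrite fromℤ≡mkℚ i | fromℤ≡mkℚ j =
  ℚ.*≤* (ℤ.*-monoʳ-≤-nonNeg (ℤ.+ 1) i≤j)

fromℤ[i*j]÷fromℤ[j] : ∀ i j .{{_ : ℚ.NonZero (fromℤ j)}} → fromℤ (i ℤ.* j) ℚ.÷ fromℤ j ≡ fromℤ i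
fromℤ[i*j]÷fromℤ[j] i j = begin
  fromℤ (i ℤ.* j) ℚ.* ℚ.1/ fromℤ j           ≡⟨ cong (ℚ._* ℚ.1/ fromℤ j) (fromℤ-* i j) ⟩
  fromℤ i ℚ.* fromℤ j ℚ.* ℚ.1/ fromℤ j       ≡⟨ ℚ.*-assoc (fromℤ i) (fromℤ j) _ ⟩
  fromℤ i ℚ.* (fromℤ j ℚ.* ℚ.1/ fromℤ j)     ≡⟨ cong (fromℤ i ℚ.*_) (ℚ.*-inverseʳ (fromℤ j)) ⟩
  fromℤ i ℚ.* ℚ.1ℚ                           ≡⟨ ℚ.*-identityʳ (fromℤ i) ⟩
  fromℤ i                                    ∎
  where open ≡-Reasoning

-- Induction by `x * y - 1 = x * (y - 1) + (x - 1)` with `y` the `m`-th power of `x`. Free of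
-- division, the identity includes `r = 1`.
r^m-1≡geometricSum*[r-1] : ∀ r m →
  (ℤ.+ r) ℤ.^ m ℤ.- ℤ.1ℤ ≡ ℤ.+ geometricSum r m ℤ.* (ℤ.+ r ℤ.- ℤ.1ℤ)
r^m-1≡geometricSum*[r-1] r zero    = refl
r^m-1≡geometricSum*[r-1] r (suc m) = begin
  x ℤ.* x ℤ.^ m ℤ.- ℤ.1ℤ                             ≡⟨ split x (x ℤ.^ m) ⟩
  x ℤ.* (x ℤ.^ m ℤ.- ℤ.1ℤ) ℤ.+ (x ℤ.- ℤ.1ℤ)          ≡⟨ cong (λ y → x ℤ.* y ℤ.+ (x ℤ.- ℤ.1ℤ)) (r^m-1≡geometricSum*[r-1] r m) ⟩
  x ℤ.* (s ℤ.* (x ℤ.- ℤ.1ℤ)) ℤ.+ (x ℤ.- ℤ.1ℤ)        ≡⟨ collect x s ⟩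
  (ℤ.1ℤ ℤ.+ x ℤ.* s) ℤ.* (x ℤ.- ℤ.1ℤ)                ≡⟨ cong (λ y → (ℤ.1ℤ ℤ.+ y) ℤ.* (x ℤ.- ℤ.1ℤ)) (ℤ.pos-* r (geometricSum r m)) ⟨
  ℤ.+ geometricSum r (suc m) ℤ.* (x ℤ.- ℤ.1ℤ)        ∎
  where
  open ≡-Reasoning
  x s : ℤ
  x = ℤ.+ r
  s = ℤ.+ geometricSum r m
  split : ∀ x y → x ℤ.* y ℤ.- ℤ.1ℤ ≡ x ℤ.* (y ℤ.- ℤ.1ℤ) ℤ.+ (x ℤ.- ℤ.1ℤ)
  split = solve-∀
  collect : ∀ x s → x ℤ.* (s ℤ.* (x ℤ.- ℤ.1ℤ)) ℤ.+ (x ℤ.- ℤ.1ℤ) ≡ (ℤ.1ℤ ℤ.+ x ℤ.* s) ℤ.* (x ℤ.- ℤ.1ℤ)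
  collect = solve-∀

-- At D = 0, where D ∸ 1 ≠ D − 1, the factor D makes both sides vanish.

D*geometricQuotient : ∀ D m (D≢2 : D ≢ 2) →
  fromℕ-ℚ D ℚ.* geometricQuotient D m D≢2 ≡ fromℕ-ℚ (D * geometricSum (D ∸ 1) m)
D*geometricQuotient zero    m D≢2 = ℚ.*-zeroˡ (geometricQuotient 0 m D≢2)
D*geometricQuotient (suc r) m D≢2 = begin
  x ℚ.* (fromℤ ((ℤ.+ r) ℤ.^ m ℤ.- ℤ.1ℤ) ℚ.÷ fromℤ D-2)  ≡⟨ cong (λ i → x ℚ.* (fromℤ i ℚ.÷ fromℤ D-2)) numerator ⟩
  x ℚ.* (fromℤ (s ℤ.* D-2) ℚ.÷ fromℤ D-2)             ≡⟨ cong (x ℚ.*_) (fromℤ[i*j]÷fromℤ[j] s D-2) ⟩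
  x ℚ.* fromℤ s                                       ≡⟨ fromℤ-* (ℤ.+ suc r) s ⟨
  fromℤ (ℤ.+ suc r ℤ.* s)                             ≡⟨ cong fromℤ (ℤ.pos-* (suc r) (geometricSum r m)) ⟨
  fromℕ-ℚ (suc r * geometricSum r m)                  ∎
  where
  open ≡-Reasoning
  instance _ = D-2-nonZero D≢2
  x : ℚ
  x = fromℕ-ℚ (suc r)
  s D-2 : ℤ
  s   = ℤ.+ geometricSum r m
  D-2 = ℤ.+ suc r ℤ.- ℤ.+ 2
  numerator : (ℤ.+ r) ℤ.^ m ℤ.- ℤ.1ℤ ≡ s ℤ.* D-2
  numerator = trans (r^m-1≡geometricSum*[r-1] r m) (cong (s ℤ.*_)
    (trans (ℤ.m-n≡m⊖n r 1) (sym (ℤ.[1+m]⊖[1+n]≡m⊖n r 1))))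

-- Both bounds assembled

χ-≤ : ∀ G k d 1≤k-1 {c} → 1 ≤ c → Colourable G k d c → χ G k d 1≤k-1 ≤ c
χ-≤ G k d 1≤k-1 1≤c colourable =
  proj₂ (proj₂ (chromaticNumber-exists G k d 1≤k-1)) _ (1≤c , colourable)

proposition2p10 : (k d : ℕ) → 1 ≤ k → 1 ≤ d → (1≤k-1 : 1 ≤ k ∸ 1) → k ∸ 1 ≤ d →
    (G : Graph) →
    (χ G k d 1≤k-1 ≤ Δ (G ^ᴳ (d + 2 ∸ k)) + 1)
    × ((Δ≢2 : Δ G ≢ 2) →
    fromℕ-ℚ (Δ (G ^ᴳ (d + 2 ∸ k)) + 1) ℚ.≤
    fromℕ-ℚ (Δ G) ℚ.* geometricQuotient (Δ G) (d + 2 ∸ k) Δ≢2 ℚ.+ ℚ.1ℚ)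
proposition2p10 (suc k) d 1≤k 1≤d 1≤k-1 k-1≤d G =
  χ-≤ G (suc k) d 1≤k-1 (m≤n+m 1 _) (proj₁ proper , proper^ᴳ⇒colouring G (s≤s 1≤k-1) 1+d<1+k+ℓ (proj₂ proper)) ,
  λ Δ≢2 → begin
    fromℕ-ℚ (Δ (G ^ᴳ ℓ) + 1)                                     ≤⟨ fromℤ-mono-≤ (ℤ.+≤+ (+-monoˡ-≤ 1 (Δ^ᴳ-≤ G ℓ))) ⟩
    fromℕ-ℚ (Δ G * geometricSum (Δ G ∸ 1) ℓ + 1)                 ≡⟨ fromℤ-+ (ℤ.+ (Δ G * geometricSum (Δ G ∸ 1) ℓ)) (ℤ.+ 1) ⟩
    fromℕ-ℚ (Δ G * geometricSum (Δ G ∸ 1) ℓ) ℚ.+ ℚ.1ℚ            ≡⟨ cong (ℚ._+ ℚ.1ℚ) (D*geometricQuotient (Δ G) ℓ Δ≢2) ⟨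
    fromℕ-ℚ (Δ G) ℚ.* geometricQuotient (Δ G) ℓ Δ≢2 ℚ.+ ℚ.1ℚ     ∎
  where
  open ℚ.≤-Reasoning
  ℓ : ℕ
  ℓ = d + 2 ∸ suc k
  proper = Greedy.properColouring (G ^ᴳ ℓ) (m<m+n (Δ (G ^ᴳ ℓ)) z<s)
  1+d<1+k+ℓ : suc d < suc k + ℓ
  -- The `k` of the statement is `suc k` here. As `k ≤ d`, the subtraction in `ℓ` does not truncate
  -- and `suc k + ℓ` is exactly `d + 2`.
  1+d<1+k+ℓ = ≤-reflexive (trans (+-comm 2 d)
    (sym (m+[n∸m]≡n (≤-trans (s≤s k-1≤d) (≤-trans (n≤1+n (suc d)) (≤-reflexive (+-comm 2 d)))))))
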